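{- $S(3,4) = \mathbb{N}_0 \setminus \left([1,7] \cup [9,11] \cup \{13\}\right)$, where $[a,b] = \{a, a+1, \dots, b\}$ for integers $a<b$.
   Context: Let $t \le k$ and $v$ be positive integers, $V = \{1,\dots,v\}$, and let $V^k$ be the set of ordered $k$-tuples of elements of $V$. For a $t$-subset $I = \{i_1 < \cdots < i_t\}$ of $\{1,\dots,k\}$ and $(u_1,\dots,u_t) \in V^t$, the tuple $(x_1,\dots,x_k) \in V^k$ is said to contain $(u_1,\dots,u_t)_I$ if $x_{i_j} = u_j$ for all $j = 1,\dots,t$. A $t$-$(v,k)$ Latin trade of volume $s$ is a pair $T = (T_1,T_2)$ of disjoint collections (finite multisets, i.e. repeated elements are allowed; disjoint means no tuple occurs in both), each consisting of $s$ elements of $V^k$ counted with multiplicity, such that for each $t$-subset $I \subseteq \{1,\dots,k\}$ and each $(u_1,\dots,u_t) \in V^t$, the number of elements (with multiplicity) of $T_1$ containing $(u_1,\dots,u_t)_I$ equals the number of elements of $T_2$ containing $(u_1,\dots,u_t)_I$. The trade with $T_1 = T_2 = \emptyset$ (volume $0$) is allowed. The spectrum $S(t,k)$ is the set of all integers $s$ for which there exists, for some $v$, a $t$-$(v,k)$ Latin trade of volume $s$. $\mathbb{N}_0$ denotes the nonnegative integers. -}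

module Defs where

open import Data.Fin.Base as Fin using (Fin)
import Data.Fin.Properties as Fin
open import Data.List.Base using (List; length; filter)
open import Data.List.Relation.Binary.Disjoint.Propositional using (Disjoint)
open import Data.Nat.Base using (ℕ; _≤_; _<_)
open import Data.Product.Base using (∃-syntax; _×_)
open import Data.Vec.Base using (Vec; lookup)
open import Level using (0ℓ)
open import Relation.Binary.Core using (_Preserves_⟶_)
open import Relation.Binary.PropositionalEquality.Core using (_≡_)
open import Relation.Unary using (Pred; Decidable)

private
  variable
    t k v : ℕ

Tuple : ℕ → ℕ → Set
Tuple v k = Vec (Fin v) k

-- A t-subset {i₁ < ⋯ < iₜ} of the k positions is given by its increasing
-- enumeration, so each t-subset is represented exactly once.
record Positions (t k : ℕ) : Set where
  field
    elements   : Vec (Fin k) t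
    increasing : lookup elements Preserves Fin._<_ ⟶ Fin._<_

open Positions public

Contains : Positions t k → Tuple v t → Pred (Tuple v k) 0ℓ
Contains I u x = ∀ j → lookup x (lookup (elements I) j) ≡ lookup u j

contains? : (I : Positions t k) (u : Tuple v t) → Decidable (Contains I u)
contains? I u x = Fin.all? λ j → lookup x (lookup (elements I) j) Fin.≟ lookup u j

-- Finite multisets are represented by lists; everything below is invariant
-- under permuting them.
occurrences : Positions t k → Tuple v t → List (Tuple v k) → ℕ
occurrences I u T = length (filter (contains? I u) T)

record IsLatinTrade (t v k s : ℕ) (T₁ T₂ : List (Tuple v k)) : Set where
  field
    volume₁  : length T₁ ≡ s
    volume₂  : length T₂ ≡ s
    disjoint : Disjoint T₁ T₂
    balanced : (I : Positions t k) (u : Tuple v t) →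
               occurrences I u T₁ ≡ occurrences I u T₂

-- Volumes are cardinalities, so the spectrum is a set of natural numbers.
-- It is of interest only for 1 ≤ t ≤ k.
Spectrum : ℕ → ℕ → Pred ℕ 0ℓ
Spectrum t k s =
  ∃[ v ] 0 < v × (∃[ T₁ ] ∃[ T₂ ] IsLatinTrade t v k s T₁ T₂)

Interval : ℕ → ℕ → Pred ℕ 0ℓ
Interval a b n = a ≤ n × n ≤ b

{-# OPTIONS --safe #-}

-- Fixing the first coordinate to a slices a trade for (k+1, k+2) of volume s into
-- trades for (k, k+1) of volumes sₐ with Σ sₐ = s.  Since T₁ and T₂ are disjoint,
-- 2 sₐ ≤ s.  Hence if d divides every volume n of a (k, k+1) trade with 2 n ≤ s, then
-- d divides s.  With d = 0 this gives the minimal positive volume 2ᵏ; with d = 2 it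
-- excludes 5 from S(2,3), after which d = 4 excludes 9, 10, 11 and d = 2 excludes 13
-- from S(3,4).  Conversely, explicit trades on three symbols in every residue class
-- mod 8 can be enlarged by any number of copies of the cube of volume 8.

module Submission where

open import Data.Bool.Base using (true; false)
open import Data.Fin.Base as Fin using (Fin; zero; suc)
open import Data.Fin.Patterns using (0F; 1F; 2F; 3F; 4F; 5F; 6F; 7F)
import Data.Fin.Properties as Fin
open import Data.List.Base using (List; []; _∷_; [_]; _++_; length; filter; map)
open import Data.List.Membership.DecPropositional using (_∈?_)
open import Data.List.Membership.Propositional using (_∈_; _∉_)
open import Data.List.Membership.Propositional.Properties
  using (∈-map⁻; ∈-filter⁻; ∈-++⁺ˡ; ∈-++⁺ʳ; ∈-++⁻)
open import Data.List.Properties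
  using (filter-++; filter-all; filter-none; filter-≐; length-++; length-map)
open import Data.List.Relation.Binary.Disjoint.DecPropositional using (disjoint?)
open import Data.List.Relation.Binary.Disjoint.Propositional using (Disjoint)
open import Data.List.Relation.Binary.Sublist.Propositional.Properties
  using (filter-⊆; filter⁺; length-mono-≤; map⁺)
open import Data.List.Relation.Unary.Any using (here; there)
import Data.List.Relation.Unary.All as All
open import Data.Nat.Base
open import Data.Nat.Divisibility
open import Data.Nat.DivMod using (_divMod_; result; _mod_; _/_; _%_)
open import Data.Nat.GeneralisedArithmetic using (fold)
open import Data.Nat.Properties
open import Data.Product.Base using (_×_; _,_; proj₁; proj₂)
open import Data.Sum.Base using (inj₁; inj₂)
open import Data.Vec.Base as Vec using (Vec; []; _∷_; head; tail; lookup)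
open import Data.Vec.Properties using (≡-dec; lookup-map)
open import Function.Base using (_∘_; id)
open import Level using (0ℓ)
open import Relation.Binary.PropositionalEquality
  using (_≡_; refl; sym; trans; cong; cong₂; subst; subst₂; module ≡-Reasoning)
open import Relation.Nullary using (Dec; yes; no; does; ¬_; contradiction)
open import Relation.Nullary.Decidable
  using (_×-dec_; _→-dec_; _⊎-dec_; ¬?; map′; from-yes; from-no; True; toWitness)
open import Relation.Unary using (Decidable; Pred; _≐_; _∪_; _∖_; ｛_｝; U)

open import Defs

open import Algebra.Properties.CommutativeMonoid.Sum +-0-commutativeMonoid
  using (sum; sum-syntax; sum-cong-≗; sum-replicate-zero; ∑-distrib-+)

open IsLatinTrade

private
  variable
    A B : Set
    s s′ t k v d : ℕ
    T₁ T₂ T₁′ T₂′ : List (Tuple v k)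

-- Finite sums and counting a list by fibres

∑-mono-≤ : {f g : Fin v → ℕ} → (∀ a → f a ≤ g a) → sum f ≤ sum g
∑-mono-≤ {v = zero}  f≤g = z≤n
∑-mono-≤ {v = suc v} f≤g = +-mono-≤ (f≤g zero) (∑-mono-≤ (f≤g ∘ suc))

∣-∑ : {f : Fin v → ℕ} → (∀ a → d ∣ f a) → d ∣ sum f
∣-∑ {v = zero}  {d} d∣f = d ∣0
∣-∑ {v = suc v}     d∣f = ∣m∣n⇒∣m+n (d∣f zero) (∣-∑ (d∣f ∘ suc))

∑-indicator : (i : Fin v) (x : A) →
              ∑[ a < v ] length (filter (λ _ → i Fin.≟ a) [ x ]) ≡ 1
∑-indicator {v = suc v} zero    x = cong suc (sum-replicate-zero v)
∑-indicator {v = suc v} (suc i) x = trans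
  (sum-cong-≗ λ a → cong length
    (filter-≐ (λ _ → suc i Fin.≟ suc a) (λ _ → i Fin.≟ a)
      (Fin.suc-injective , cong suc) [ x ]))
  (∑-indicator i x)

length-∑-fibres : (f : A → Fin v) (xs : List A) →
                  length xs ≡ ∑[ a < v ] length (filter (λ x → f x Fin.≟ a) xs)
length-∑-fibres {v = v} f []       = sym (sum-replicate-zero v)
length-∑-fibres {v = v} f (x ∷ xs) = begin
  1 + length xs
    ≡⟨ cong₂ _+_ (sym (trans (sum-cong-≗ head-fibre) (∑-indicator (f x) x)))
                 (length-∑-fibres f xs) ⟩
  sum (fibre [ x ]) + sum (fibre xs)
    ≡⟨ ∑-distrib-+ (fibre [ x ]) (fibre xs) ⟨
  ∑[ a < v ] (fibre [ x ] a + fibre xs a)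
    ≡⟨ sum-cong-≗ (λ a → trans
         (cong length (filter-++ (λ y → f y Fin.≟ a) [ x ] xs))
         (length-++ (filter (λ y → f y Fin.≟ a) [ x ]))) ⟨
  sum (fibre (x ∷ xs)) ∎
  where
  open ≡-Reasoning
  fibre : List _ → Fin v → ℕ
  fibre ys a = length (filter (λ y → f y Fin.≟ a) ys)
  head-fibre : ∀ a → fibre [ x ] a ≡ length (filter (λ _ → f x Fin.≟ a) [ x ])
  head-fibre a with does (f x Fin.≟ a)
  ... | true  = refl
  ... | false = refl

module _ {P : Pred B 0ℓ} (P? : Decidable P) where

  length-filter-map : (f : A → B) (xs : List A) →
                      length (filter P? (map f xs)) ≡ length (filter (P? ∘ f) xs)
  length-filter-map f []       = refl
  length-filter-map f (x ∷ xs) with does (P? (f x))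
  ... | true  = cong suc (length-filter-map f xs)
  ... | false = length-filter-map f xs

module _ {P Q : Pred A 0ℓ} (P? : Decidable P) (Q? : Decidable Q) where

  filter-filter : (xs : List A) →
                  filter P? (filter Q? xs) ≡ filter (λ x → Q? x ×-dec P? x) xs
  filter-filter []       = refl
  filter-filter (x ∷ xs) with does (Q? x)
  ... | false = filter-filter xs
  ... | true  with does (P? x)
  ...   | true  = cong (x ∷_) (filter-filter xs)
  ...   | false = filter-filter xs

-- Sets of positions under a new first coordinate

shift : Positions t k → Positions t (suc k)
shift I .elements   = Vec.map suc (elements I)
shift I .increasing {i} {j} i<j = subst₂ Fin._<_
  (sym (lookup-map i suc (elements I))) (sym (lookup-map j suc (elements I)))
  (s<s (increasing I i<j))

cons : Positions t k → Positions (suc t) (suc k)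
cons I .elements = zero ∷ elements (shift I)
cons I .increasing {zero}  {suc j} _   =
  subst (0 <_) (cong Fin.toℕ (sym (lookup-map j suc (elements I)))) z<s
cons I .increasing {suc i} {suc j} i<j = increasing (shift I) {i} {j} (s<s⁻¹ i<j)

-- The first `t` positions. One `t`-subset already determines the length of a list from its
-- occurrence counts, and this one is convenient for induction.
initial : t ≤ k → Positions t k
initial z≤n     = record { elements = [] ; increasing = λ { {()} } }
initial (s≤s p) = cons (initial p)

module _ (I : Positions t k) (u : Tuple v t) where

  Contains-shift : Contains (shift I) u ≐ Contains I u ∘ tail
  Contains-shift =
      (λ { {y ∷ x} c j → trans (sym (lookup-shift y x j)) (c j) })
    , (λ { {y ∷ x} c j → trans (lookup-shift y x j) (c j) })
    where
    lookup-shift : ∀ y (x : Tuple v k) j →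
      lookup (y ∷ x) (lookup (elements (shift I)) j) ≡ lookup x (lookup (elements I) j)
    lookup-shift y x j = cong (lookup (y ∷ x)) (lookup-map j suc (elements I))

  Contains-cons : ∀ a → Contains (cons I) (a ∷ u) ≐ λ x → head x ≡ a × Contains I u (tail x)
  Contains-cons a =
      (λ { {y ∷ x} c → c zero , proj₁ Contains-shift {y ∷ x} (c ∘ suc) })
    , (λ { {y ∷ x} (y≡a , c) zero    → y≡a
         ; {y ∷ x} (y≡a , c) (suc j) → proj₂ Contains-shift {y ∷ x} c j })

-- With all `k` positions prescribed, containment is equality, so `occurrences (initial ≤-refl) u`
-- is the multiplicity of `u`.
Contains-initial-refl : (u x : Tuple v k) → Contains (initial ≤-refl) u x → x ≡ u
Contains-initial-refl []      []      c = refl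
Contains-initial-refl (a ∷ u) (y ∷ x) c =
  let y≡a , c′ = proj₁ (Contains-cons (initial ≤-refl) u a) {y ∷ x} c
  in cong₂ _∷_ y≡a (Contains-initial-refl u x c′)

-- Slices and occurrence counts

slice : Fin v → List (Tuple v (suc k)) → List (Tuple v k)
slice a T = map tail (filter (λ x → head x Fin.≟ a) T)

∈-slice⁻ : ∀ {a} {x : Tuple v k} T → x ∈ slice a T → a ∷ x ∈ T
∈-slice⁻ {a = a} T x∈ with ∈-map⁻ tail x∈
... | _ ∷ _ , y∈ , refl with ∈-filter⁻ (λ x → head x Fin.≟ a) y∈
...   | y∈T , refl = y∈T

length-∑-slices : (T : List (Tuple v (suc k))) →
                  length T ≡ ∑[ a < v ] length (slice a T)
length-∑-slices T = trans (length-∑-fibres head T)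
  (sum-cong-≗ λ a → sym (length-map tail (filter (λ x → head x Fin.≟ a) T)))

module _ (I : Positions t k) (u : Tuple v t) where

  occurrences-++ : ∀ xs ys → occurrences I u (xs ++ ys) ≡
                             occurrences I u xs + occurrences I u ys
  occurrences-++ xs ys = trans (cong length (filter-++ (contains? I u) xs ys))
                               (length-++ (filter (contains? I u) xs))

  occurrences-shift : ∀ T → occurrences (shift I) u T ≡ occurrences I u (map tail T)
  occurrences-shift T = trans
    (cong length
      (filter-≐ (contains? (shift I) u) (contains? I u ∘ tail) (Contains-shift I u) T))
    (sym (length-filter-map (contains? I u) tail T))

  occurrences-cons : ∀ a T → occurrences (cons I) (a ∷ u) T ≡ occurrences I u (slice a T)
  occurrences-cons a T = trans
    (cong length (trans
      (filter-≐ (contains? (cons I) (a ∷ u)) _ (Contains-cons I u a) T)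
      (sym (filter-filter (contains? I u ∘ tail) (λ x → head x Fin.≟ a) T))))
    (sym (length-filter-map (contains? I u) tail (filter (λ x → head x Fin.≟ a) T)))

  occurrences-slice-≤ : ∀ a T → occurrences I u (slice a T) ≤ occurrences I u (map tail T)
  occurrences-slice-≤ a T = length-mono-≤
    (filter⁺ (contains? I u) (contains? I u) (λ { refl → id })
      (map⁺ tail (filter-⊆ (λ x → head x Fin.≟ a) T)))

occurrences-initial-∉ : {u : Tuple v k} {T : List (Tuple v k)} →
                        u ∉ T → occurrences (initial ≤-refl) u T ≡ 0
occurrences-initial-∉ {u = u} u∉T = cong length
  (filter-none (contains? (initial ≤-refl) u)
    (All.tabulate λ {x} x∈T c → u∉T (subst (_∈ _) (Contains-initial-refl u x c) x∈T)))

-- Each tuple contains exactly one `u` at the initial positions, so the counts over all `u` add up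
-- to the length. The induction splits off the first entry of `u` by slicing.
occurrences-≤⇒length-≤ : (t≤k : t ≤ k) (xs ys : List (Tuple v k)) →
  (∀ u → occurrences (initial t≤k) u xs ≤ occurrences (initial t≤k) u ys) →
  length xs ≤ length ys
occurrences-≤⇒length-≤ z≤n xs ys occ≤ =
  subst₂ _≤_ (occurrences-[] xs) (occurrences-[] ys) (occ≤ [])
  where
  occurrences-[] : ∀ T → occurrences (initial z≤n) [] T ≡ length T
  occurrences-[] T = cong length
    (filter-all (contains? (initial z≤n) []) (All.universal (λ _ ()) T))
occurrences-≤⇒length-≤ (s≤s t≤k) xs ys occ≤ =
  subst₂ _≤_ (sym (length-∑-slices xs)) (sym (length-∑-slices ys))
    (∑-mono-≤ λ a → occurrences-≤⇒length-≤ t≤k (slice a xs) (slice a ys) λ u →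
      subst₂ _≤_ (occurrences-cons (initial t≤k) u a xs)
                 (occurrences-cons (initial t≤k) u a ys) (occ≤ (a ∷ u)))

-- Slices of a trade

-- Prescribing `u` at `I` in the slice amounts to prescribing `a ∷ u` at `cons I` in the trade.
-- Equality of the two volumes follows from balance at a single set of positions, which `t ≤ k`
-- supplies.
slice-isLatinTrade : t ≤ k → IsLatinTrade (suc t) v (suc k) s T₁ T₂ → ∀ a →
                     IsLatinTrade t v k (length (slice a T₁)) (slice a T₁) (slice a T₂)
slice-isLatinTrade {T₁ = T₁} {T₂} t≤k T a = record
  { volume₁  = refl
  ; volume₂  = ≤-antisym
      (occurrences-≤⇒length-≤ t≤k S₂ S₁ λ u → ≤-reflexive (sym (balance (initial t≤k) u)))
      (occurrences-≤⇒length-≤ t≤k S₁ S₂ λ u → ≤-reflexive (balance (initial t≤k) u))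
  ; disjoint = λ (x∈₁ , x∈₂) → disjoint T (∈-slice⁻ T₁ x∈₁ , ∈-slice⁻ T₂ x∈₂)
  ; balanced = balance
  }
  where
  S₁ = slice a T₁
  S₂ = slice a T₂
  balance : ∀ I u → occurrences I u S₁ ≡ occurrences I u S₂
  balance I u = trans (sym (occurrences-cons I u a T₁))
    (trans (balanced T (cons I) (a ∷ u)) (occurrences-cons I u a T₂))

-- The two slices are disjoint and each is contained in the common multiset of tails of
-- T₁ and T₂, so their union is contained in it as well.
slice-volume : IsLatinTrade (suc k) v (suc (suc k)) s T₁ T₂ → ∀ a →
               2 * length (slice a T₁) ≤ s
slice-volume {k = k} {s = s} {T₁} {T₂} T a = begin
  length S₁ + (length S₁ + 0)
    ≡⟨ cong (length S₁ +_) (trans (+-identityʳ (length S₁)) (sym (volume₂ S))) ⟩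
  length S₁ + length S₂
    ≡⟨ length-++ S₁ ⟨
  length (S₁ ++ S₂)
    ≤⟨ occurrences-≤⇒length-≤ ≤-refl (S₁ ++ S₂) (map tail T₁) bound ⟩
  length (map tail T₁)
    ≡⟨ trans (length-map tail T₁) (volume₁ T) ⟩
  s ∎
  where
  open ≤-Reasoning
  S₁ = slice a T₁
  S₂ = slice a T₂
  S = slice-isLatinTrade (n≤1+n k) T a
  I = initial (≤-refl {suc k})
  bound : ∀ u → occurrences I u (S₁ ++ S₂) ≤ occurrences I u (map tail T₁)
  bound u with _∈?_ (≡-dec Fin._≟_) u S₂
  ... | no u∉S₂ = begin
    occurrences I u (S₁ ++ S₂)
      ≡⟨ occurrences-++ I u S₁ S₂ ⟩
    occurrences I u S₁ + occurrences I u S₂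
      ≡⟨ cong (occurrences I u S₁ +_) (occurrences-initial-∉ u∉S₂) ⟩
    occurrences I u S₁ + 0
      ≡⟨ +-identityʳ _ ⟩
    occurrences I u S₁
      ≤⟨ occurrences-slice-≤ I u a T₁ ⟩
    occurrences I u (map tail T₁) ∎
  ... | yes u∈S₂ = begin
    occurrences I u (S₁ ++ S₂)
      ≡⟨ occurrences-++ I u S₁ S₂ ⟩
    occurrences I u S₁ + occurrences I u S₂
      ≡⟨ cong (_+ occurrences I u S₂)
           (occurrences-initial-∉ λ u∈S₁ → disjoint S (u∈S₁ , u∈S₂)) ⟩
    occurrences I u S₂
      ≤⟨ occurrences-slice-≤ I u a T₂ ⟩
    occurrences I u (map tail T₂)
      ≡⟨ occurrences-shift I u T₂ ⟨
    occurrences (shift I) u T₂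
      ≡⟨ balanced T (shift I) u ⟨
    occurrences (shift I) u T₁
      ≡⟨ occurrences-shift I u T₁ ⟩
    occurrences I u (map tail T₁) ∎

-- Divisibility constraints on small volumes

spectrum-∣ : (∀ {n} → Spectrum k (suc k) n → 2 * n ≤ s → d ∣ n) →
             Spectrum (suc k) (suc (suc k)) s → d ∣ s
spectrum-∣ {d = d} d∣ (v , 0<v , T₁ , T₂ , T) =
  subst (d ∣_) (trans (sym (length-∑-slices T₁)) (volume₁ T))
    (∣-∑ λ a → d∣ (v , 0<v , _ , _ , slice-isLatinTrade (n≤1+n _) T a) (slice-volume T a))

-- Slices of a trade of volume below `2 ^ suc k` have volume below `2 ^ k`, so they are empty by
-- induction. Emptiness is phrased as divisibility by 0 in order to use `spectrum-∣`.
spectrum-<⇒≡0 : ∀ k {s} → Spectrum k (suc k) s → s < 2 ^ k → s ≡ 0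
spectrum-<⇒≡0 zero    S s<1 = n<1⇒n≡0 s<1
spectrum-<⇒≡0 (suc k) S s<  = 0∣⇒≡0 (spectrum-∣ small S)
  where
  small : ∀ {n} → Spectrum k (suc k) n → 2 * n ≤ _ → 0 ∣ n
  small Sₙ 2n≤s = subst (0 ∣_)
    (sym (spectrum-<⇒≡0 k Sₙ (*-cancelˡ-< 2 _ _ (≤-<-trans 2n≤s s<)))) (0 ∣0)

spectrum₁₂ : ∀ {n} → Spectrum 1 2 n → n < 3 → 2 ∣ n
spectrum₁₂ S n<3 with m≤n⇒m<n∨m≡n (s≤s⁻¹ n<3)
... | inj₁ n<2  = subst (2 ∣_) (sym (spectrum-<⇒≡0 1 S n<2)) (2 ∣0)
... | inj₂ refl = ∣-refl

spectrum₂₃ : ∀ {n} → Spectrum 2 3 n → n < 6 → 4 ∣ n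
spectrum₂₃ S n<6 with m≤n⇒m<n∨m≡n (s≤s⁻¹ n<6)
... | inj₂ refl = contradiction
  (spectrum-∣ (λ S′ 2n≤5 → spectrum₁₂ S′ (*-cancelˡ-< 2 _ 3 (s≤s 2n≤5))) S)
  (from-no (2 ∣? 5))
... | inj₁ n<5 with m≤n⇒m<n∨m≡n (s≤s⁻¹ n<5)
...   | inj₁ n<4  = subst (4 ∣_) (sym (spectrum-<⇒≡0 2 S n<4)) (4 ∣0)
...   | inj₂ refl = ∣-refl

-- Deciding the trade conditions by enumeration

all-tuples? : {P : Pred (Tuple v k) 0ℓ} → Decidable P → Dec (∀ x → P x)
all-tuples? {k = zero}  P? = map′ (λ { p [] → p }) (λ p → p []) (P? [])
all-tuples? {k = suc k} P? = map′ (λ { p (a ∷ x) → p a x }) (λ p a x → p (a ∷ x))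
  (Fin.all? λ a → all-tuples? λ x → P? (a ∷ x))

-- Sets of positions are enumerated as arbitrary vectors of positions, with monotonicity as a
-- decidable premise; `occ` restates `occurrences` for such bare vectors.
isLatinTrade? : ∀ t s (T₁ T₂ : List (Tuple v k)) → Dec (IsLatinTrade t v k s T₁ T₂)
isLatinTrade? {v} {k} t s T₁ T₂ = map′
  (λ (vol₁ , vol₂ , dis , bal) → record
    { volume₁  = vol₁
    ; volume₂  = vol₂
    ; disjoint = λ {x} → dis {x}
    ; balanced = λ I → bal (elements I) λ i j → increasing I {i} {j}
    })
  (λ T → volume₁ T , volume₂ T , (λ {x} → disjoint T {x}) , λ is incr →
    balanced T record { elements = is ; increasing = λ {i} {j} → incr i j })
  (length T₁ ≟ s ×-dec length T₂ ≟ s ×-dec disjoint? (≡-dec Fin._≟_) T₁ T₂ ×-dec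
   all-tuples? λ is → increasing? is →-dec all-tuples? λ u → occ is u T₁ ≟ occ is u T₂)
  where
  occ : Vec (Fin k) t → Tuple v t → List (Tuple v k) → ℕ
  occ is u T =
    length (filter (λ x → Fin.all? λ j → lookup x (lookup is j) Fin.≟ lookup u j) T)
  increasing? : Decidable λ (is : Vec (Fin k) t) →
                ∀ i j → i Fin.< j → lookup is i Fin.< lookup is j
  increasing? is = Fin.all? λ i → Fin.all? λ j →
    i Fin.<? j →-dec lookup is i Fin.<? lookup is j

-- Unions of trades

++-isLatinTrade : IsLatinTrade t v k s T₁ T₂ → IsLatinTrade t v k s′ T₁′ T₂′ →
                  Disjoint (T₁ ++ T₁′) (T₂ ++ T₂′) →
                  IsLatinTrade t v k (s + s′) (T₁ ++ T₁′) (T₂ ++ T₂′)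
++-isLatinTrade {T₁ = T₁} {T₂} {T₁′ = T₁′} {T₂′} T T′ dis = record
  { volume₁  = trans (length-++ T₁) (cong₂ _+_ (volume₁ T) (volume₁ T′))
  ; volume₂  = trans (length-++ T₂) (cong₂ _+_ (volume₂ T) (volume₂ T′))
  ; disjoint = dis
  ; balanced = λ I u → trans (occurrences-++ I u T₁ T₁′)
      (trans (cong₂ _+_ (balanced T I u) (balanced T′ I u))
             (sym (occurrences-++ I u T₂ T₂′)))
  }

∈-fold-++ : ∀ {x : A} xs ys m → x ∈ fold ys (xs ++_) m → x ∈ xs ++ ys
∈-fold-++ xs ys zero    x∈ = ∈-++⁺ʳ xs x∈
∈-fold-++ xs ys (suc m) x∈ with ∈-++⁻ xs x∈
... | inj₁ x∈xs  = ∈-++⁺ˡ x∈xs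
... | inj₂ x∈′   = ∈-fold-++ xs ys m x∈′

-- Disjointness depends only on which tuples occur, so checking it for one copy of the first trade
-- settles it for every `m`.
fold-++-isLatinTrade : IsLatinTrade t v k s T₁ T₂ → IsLatinTrade t v k s′ T₁′ T₂′ →
  Disjoint (T₁ ++ T₁′) (T₂ ++ T₂′) →
  ∀ m → IsLatinTrade t v k (m * s + s′) (fold T₁′ (T₁ ++_) m) (fold T₂′ (T₂ ++_) m)
fold-++-isLatinTrade T T′ dis zero = T′
fold-++-isLatinTrade {t} {v} {k} {s} {T₁} {T₂} {s′} {T₁′} {T₂′} T T′ dis (suc m) =
  subst (λ n → IsLatinTrade t v k n (T₁ ++ fold T₁′ (T₁ ++_) m) (T₂ ++ fold T₂′ (T₂ ++_) m))
    (sym (+-assoc s (m * s) s′))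
    (++-isLatinTrade T (fold-++-isLatinTrade T T′ dis m)
      λ (x∈₁ , x∈₂) → dis (∈-fold-++ T₁ T₁′ (suc m) x∈₁ , ∈-fold-++ T₂ T₂′ (suc m) x∈₂))

-- Explicit trades on three symbols

-- Tuples over {1, 2, 3} are encoded by their decimal digits; the symbol 3 becomes 0.
tuple : ℕ → Tuple 3 4
tuple n = symbol (n / 1000) ∷ symbol (n / 100) ∷ symbol (n / 10) ∷ symbol n ∷ []
  where
  symbol : ℕ → Fin 3
  symbol m = (m % 10) mod 3

-- The tuples over {1,2} with an even and with an odd number of 2s. Once three coordinates are
-- fixed, the fourth can be chosen in one way for each parity.
cube₁ cube₂ : List (Tuple 3 4)
cube₁ = map tuple
  (1111 ∷ 1122 ∷ 1212 ∷ 1221 ∷ 2112 ∷ 2121 ∷ 2211 ∷ 2222 ∷ [])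
cube₂ = map tuple
  (1112 ∷ 1121 ∷ 1211 ∷ 1222 ∷ 2111 ∷ 2122 ∷ 2212 ∷ 2221 ∷ [])

cube-isLatinTrade : IsLatinTrade 3 3 4 8 cube₁ cube₂
cube-isLatinTrade = from-yes (isLatinTrade? 3 8 cube₁ cube₂)

SpectrumMod8 : ℕ → Set
SpectrumMod8 s = ∀ m → Spectrum 3 4 (m * 8 + s)

add-8 : SpectrumMod8 s → SpectrumMod8 (8 + s)
add-8 {s} S m = subst (Spectrum 3 4)
  (trans (cong (_+ s) (+-comm 8 (m * 8))) (+-assoc (m * 8) 8 s)) (S (suc m))

-- Both conditions are decided during type checking. The second also ensures that no tuple of one
-- side cancels against a cube tuple of the other.
add-cubes : ∀ s (N₁ N₂ : List ℕ) →
  let T₁ = map tuple N₁ ; T₂ = map tuple N₂ in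
  {True (isLatinTrade? 3 s T₁ T₂)} →
  {True (disjoint? (≡-dec Fin._≟_) (cube₁ ++ T₁) (cube₂ ++ T₂))} →
  SpectrumMod8 s
add-cubes s N₁ N₂ {trade} {compatible} m =
  3 , z<s , _ , _ ,
  fold-++-isLatinTrade cube-isLatinTrade (toWitness trade) (toWitness compatible) m

seed-0 : SpectrumMod8 0
seed-0 = add-cubes 0 [] []

-- The cubes {1,2}⁴ and {1,2}²×{2,3}² with signs chosen to cancel on the four common tuples, those
-- ending in 22: 8 + 8 - 4 = 12.
seed-12 : SpectrumMod8 12
seed-12 = add-cubes 12
  (1111 ∷ 1123 ∷ 1132 ∷ 1212 ∷ 1221 ∷ 1233 ∷ 2112 ∷ 2121 ∷ 2133 ∷ 2211 ∷
   2223 ∷ 2232 ∷ [])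
  (1112 ∷ 1121 ∷ 1133 ∷ 1211 ∷ 1223 ∷ 1232 ∷ 2111 ∷ 2123 ∷ 2132 ∷ 2212 ∷
   2221 ∷ 2233 ∷ [])

-- The cubes {1,2}²×{1,3}² and {1,3}×{2,3}×{1,3}×{2,3} cancel on the common tuples 1213 and 1233: 8
-- + 8 - 2 = 14.
seed-14 : SpectrumMod8 14
seed-14 = add-cubes 14
  (1111 ∷ 1133 ∷ 1212 ∷ 1231 ∷ 1313 ∷ 1332 ∷ 2113 ∷ 2131 ∷ 2211 ∷ 2233 ∷
   3213 ∷ 3232 ∷ 3312 ∷ 3333 ∷ [])
  (1113 ∷ 1131 ∷ 1211 ∷ 1232 ∷ 1312 ∷ 1333 ∷ 2111 ∷ 2133 ∷ 2213 ∷ 2231 ∷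
   3212 ∷ 3233 ∷ 3313 ∷ 3332 ∷ [])

-- The cubes {1,3}×{2,3}³ and {2,3}×{1,3}²×{1,2} cancel on the single common tuple 3332: 8 + 8 - 1 =
-- 15.
seed-15 : SpectrumMod8 15
seed-15 = add-cubes 15
  (1223 ∷ 1232 ∷ 1322 ∷ 1333 ∷ 2112 ∷ 2131 ∷ 2311 ∷ 2332 ∷ 3111 ∷ 3132 ∷
   3222 ∷ 3233 ∷ 3312 ∷ 3323 ∷ 3331 ∷ [])
  (1222 ∷ 1233 ∷ 1323 ∷ 1332 ∷ 2111 ∷ 2132 ∷ 2312 ∷ 2331 ∷ 3112 ∷ 3131 ∷
   3223 ∷ 3232 ∷ 3311 ∷ 3322 ∷ 3333 ∷ [])

-- The slices have volumes 6, 4 and 7. The third is the negated sum of the first two, in which three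
-- tuples cancel.
seed-17 : SpectrumMod8 17
seed-17 = add-cubes 17
  (1113 ∷ 1122 ∷ 1223 ∷ 1232 ∷ 1312 ∷ 1333 ∷ 2112 ∷ 2121 ∷ 2311 ∷ 2322 ∷
   3111 ∷ 3123 ∷ 3222 ∷ 3233 ∷ 3313 ∷ 3321 ∷ 3332 ∷ [])
  (1112 ∷ 1123 ∷ 1222 ∷ 1233 ∷ 1313 ∷ 1332 ∷ 2111 ∷ 2122 ∷ 2312 ∷ 2321 ∷
   3113 ∷ 3121 ∷ 3223 ∷ 3232 ∷ 3311 ∷ 3322 ∷ 3333 ∷ [])

-- Multiplicities are used here: 2332 and 2333 each occur twice.
seed-18 : SpectrumMod8 18
seed-18 = add-cubes 18
  (1113 ∷ 1122 ∷ 1223 ∷ 1232 ∷ 1312 ∷ 1333 ∷ 2112 ∷ 2133 ∷ 2222 ∷ 2233 ∷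
   2313 ∷ 2323 ∷ 2332 ∷ 2332 ∷ 3123 ∷ 3132 ∷ 3322 ∷ 3333 ∷ [])
  (1112 ∷ 1123 ∷ 1222 ∷ 1233 ∷ 1313 ∷ 1332 ∷ 2113 ∷ 2132 ∷ 2223 ∷ 2232 ∷
   2312 ∷ 2322 ∷ 2333 ∷ 2333 ∷ 3122 ∷ 3133 ∷ 3323 ∷ 3332 ∷ [])

seed-19 : SpectrumMod8 19
seed-19 = add-cubes 19
  (1213 ∷ 1221 ∷ 1311 ∷ 1323 ∷ 2113 ∷ 2131 ∷ 2211 ∷ 2211 ∷ 2222 ∷ 2233 ∷
   2312 ∷ 2321 ∷ 3111 ∷ 3133 ∷ 3212 ∷ 3223 ∷ 3231 ∷ 3313 ∷ 3322 ∷ [])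
  (1211 ∷ 1223 ∷ 1313 ∷ 1321 ∷ 2111 ∷ 2133 ∷ 2212 ∷ 2213 ∷ 2221 ∷ 2231 ∷
   2311 ∷ 2322 ∷ 3113 ∷ 3131 ∷ 3211 ∷ 3222 ∷ 3233 ∷ 3312 ∷ 3323 ∷ [])

-- The first slice sets a Latin square of order 3 against a disjoint one, with volume 9; the other
-- two slices have volume 6.
seed-21 : SpectrumMod8 21
seed-21 = add-cubes 21
  (1111 ∷ 1123 ∷ 1132 ∷ 1212 ∷ 1221 ∷ 1233 ∷ 1313 ∷ 1322 ∷ 1331 ∷ 2112 ∷
   2131 ∷ 2213 ∷ 2232 ∷ 2311 ∷ 2333 ∷ 3121 ∷ 3133 ∷ 3222 ∷ 3231 ∷ 3323 ∷
   3332 ∷ [])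
  (1112 ∷ 1121 ∷ 1133 ∷ 1213 ∷ 1222 ∷ 1231 ∷ 1311 ∷ 1323 ∷ 1332 ∷ 2111 ∷
   2132 ∷ 2212 ∷ 2233 ∷ 2313 ∷ 2331 ∷ 3123 ∷ 3131 ∷ 3221 ∷ 3232 ∷ 3322 ∷
   3333 ∷ [])

-- The consecutive volumes 14 to 21 represent all residues mod 8; 16 and 20 arise from 0 and 12 by
-- adding cubes.
seeds : (r : Fin 8) → SpectrumMod8 (14 + Fin.toℕ r)
seeds 0F = seed-14
seeds 1F = seed-15
seeds 2F = add-8 (add-8 seed-0)
seeds 3F = seed-17
seeds 4F = seed-18
seeds 5F = seed-19
seeds 6F = add-8 seed-12
seeds 7F = seed-21

spectrum-≥14 : ∀ n → Spectrum 3 4 (14 + n)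
spectrum-≥14 n with n divMod 8
... | result q r refl = subst (Spectrum 3 4)
  (trans (+-comm (q * 8) (14 + Fin.toℕ r)) (+-assoc 14 (Fin.toℕ r) (q * 8))) (seeds r q)

-- Comparison with the excluded set

Excluded : Pred ℕ 0ℓ
Excluded = Interval 1 7 ∪ Interval 9 11 ∪ ｛ 13 ｝

excluded? : Decidable Excluded
excluded? s = (1 ≤? s ×-dec s ≤? 7) ⊎-dec (9 ≤? s ×-dec s ≤? 11) ⊎-dec 13 ≟ s

<14-∉Excluded : ∀ {s} → s < 14 → ¬ Excluded s → s ∈ 0 ∷ 8 ∷ 12 ∷ []
<14-∉Excluded = from-yes
  (allUpTo? (λ s → ¬? (excluded? s) →-dec _∈?_ _≟_ s (0 ∷ 8 ∷ 12 ∷ [])) 14)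

∉Excluded⇒spectrum : ∀ s → ¬ Excluded s → Spectrum 3 4 s
∉Excluded⇒spectrum s s∉ with 14 ≤? s
... | yes 14≤s = subst (Spectrum 3 4) (m+[n∸m]≡n 14≤s) (spectrum-≥14 (s ∸ 14))
... | no  14≰s with <14-∉Excluded (≰⇒> 14≰s) s∉
...   | here refl                 = seed-0 0
...   | there (here refl)         = seed-0 1
...   | there (there (here refl)) = seed-12 0

spectrum⇒∉Excluded : ∀ {s} → Spectrum 3 4 s → ¬ Excluded s
spectrum⇒∉Excluded S (inj₁ (1≤s , s≤7)) =
  contradiction (spectrum-<⇒≡0 3 S (s≤s s≤7)) (>⇒≢ 1≤s)
spectrum⇒∉Excluded S (inj₂ (inj₁ (9≤s , s≤11))) =
  -- Slices have volume at most 5, hence divisible by 4, and none of 9, 10, 11 is a multiple of 4.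
  from-yes (allUpTo? (λ s → 9 ≤? s →-dec ¬? (4 ∣? s)) 12) (s≤s s≤11) 9≤s
    (spectrum-∣ (λ S′ 2n≤s → spectrum₂₃ S′
      (*-cancelˡ-< 2 _ 6 (s≤s (≤-trans 2n≤s s≤11)))) S)
spectrum⇒∉Excluded S (inj₂ (inj₂ refl)) =
  from-no (2 ∣? 13) (spectrum-∣ even S)
  where
  even : ∀ {n} → Spectrum 2 3 n → 2 * n ≤ 13 → 2 ∣ n
  -- Slices have volume at most 6. The value 6 is not divisible by 4, so only divisibility by 2 is
  -- available, which suffices for the odd number 13.
  even S′ 2n≤13 with m≤n⇒m<n∨m≡n (s≤s⁻¹ (*-cancelˡ-< 2 _ 7 (s≤s 2n≤13)))
  ... | inj₁ n<6  = ∣-trans (divides 2 refl) (spectrum₂₃ S′ n<6)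
  ... | inj₂ refl = divides 3 refl

theorem4 : Spectrum 3 4 ≐ U ∖ (Interval 1 7 ∪ Interval 9 11 ∪ ｛ 13 ｝)
theorem4 = (λ S → _ , spectrum⇒∉Excluded S) , λ (_ , s∉) → ∉Excluded⇒spectrum _ s∉
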